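{- Let $\mathrm{Ax}\subseteq\{\mathsf{N},\mathsf{P},\mathsf{D},\mathsf{T}\}$. For every sequent $\Gamma$: if $\Gamma$ is derivable in the calculus $\mathcal{C}_{\mathsf{IM}\oplus\mathrm{Ax}}$, then $\vdash_{\mathsf{IM}\oplus\mathrm{Ax}} i(\Gamma)$.
   Context: Language: $\mathcal{L}$ is generated by $\varphi ::= p \mid \bot \mid \varphi\wedge\varphi \mid \varphi\vee\varphi \mid \varphi\to\varphi \mid \Box\varphi \mid \Diamond\varphi$; $\neg\varphi := \varphi\to\bot$, $\top := \neg\bot$. Logics: $\mathsf{IM}$ is obtained by extending an axiomatisation of intuitionistic propositional logic over $\mathcal{L}$ with the rules "from $\varphi\to\psi$ infer $\Box\varphi\to\Box\psi$" and "from $\varphi\to\psi$ infer $\Diamond\varphi\to\Diamond\psi$" and the axioms $(\Box\varphi\wedge\Diamond\neg\varphi)\to\bot$ and $(\Box\top\to\Diamond\varphi)\to\Diamond\varphi$, closed under modus ponens and uniform substitution. $\mathsf{IM}\oplus\mathrm{Ax}$ additionally has the axioms in $\mathrm{Ax}$ (with the same closure), where $\mathsf{N}$ is $\Box\top$; $\mathsf{P}$ is $\Diamond\top$; $\mathsf{D}$ is $\Box\varphi\to\Diamond\varphi$; $\mathsf{T}$ is the conjunction of $\Box\varphi\to\varphi$ and $\varphi\to\Diamond\varphi$. Sequents: a marked formula is an input formula $\varphi^\bullet$ or an output formula $\varphi^\circ$ with $\varphi\in\mathcal{L}$. A block is $\{\Delta\}$ where $\Delta$ contains at most one marked formula; it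 is an input block if $\Delta=\varphi^\bullet$ or $\Delta$ is empty, and an output block if $\Delta=\varphi^\circ$. A sequent has the form $\Gamma=\Lambda,\Pi$ where $\Lambda$ is a finite multiset of input formulas and input blocks and $\Pi$ is empty, or one output formula $\varphi^\circ$, or one output block $\{\varphi^\circ\}$. Below $\Gamma$ ranges over sequents, $\Lambda$ over sequents with only input components, $|\Delta|$ is the number of formulas in $\Delta$, and all rule instances must consist of sequents. The output pruning $\Gamma^\downarrow$ is $\Gamma$ with its output formula (if any) removed; if the output formula is inside a block, the block is kept but emptied to $\{\ \}$ (so $\{\varphi^\bullet\}^\downarrow=\{\varphi^\bullet\}$, $\{\varphi^\circ\}^\downarrow=\{\ \}$). Formula interpretation: put $\iota(\varphi^\bullet)=\iota(\varphi^\circ)=\varphi$, $\iota(\{\ \})=\Box\top$, $\iota(\{\varphi^\bullet\})=\Box\varphi$, $\iota(\{\varphi^\circ\})=\Diamond\varphi$, $\iota(\emptyset)=\bot$, and $i(\Lambda,\Pi)=\big(\bigwedge_{x\in\Lambda}\iota(x)\big)\to\iota(\Pi)$, with empty conjunction $\top$. Rules of $\mathcal{C}_{\mathsf{IM}}$ (premisses / conclusion): $\bot^\bullet$: (no premiss) / $\Gamma,\bot^\bullet$. $\mathsf{id}$: (no premiss) / $\Lambda,p^\bullet,p^\circ$ ($p$ a proposition letter). $\wedge^\bullet$: $\Gamma,\varphi^\bullet,\psi^\bullet$ / $\Gamma,(\varphi\wedge\psi)^\bullet$. $\wedge^\circ$: $\Lambda,\varphi^\circ$ and $\Lambda,\psi^\circ$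 / $\Lambda,(\varphi\wedge\psi)^\circ$. $\vee^\bullet$: $\Gamma,\varphi^\bullet$ and $\Gamma,\psi^\bullet$ / $\Gamma,(\varphi\vee\psi)^\bullet$. $\vee^\circ$: $\Lambda,\varphi^\circ$ / $\Lambda,(\varphi\vee\psi)^\circ$; and $\Lambda,\psi^\circ$ / $\Lambda,(\varphi\vee\psi)^\circ$. $\to^\bullet$: $\Gamma^\downarrow,(\varphi\to\psi)^\bullet,\varphi^\circ$ and $\Gamma,\psi^\bullet$ / $\Gamma,(\varphi\to\psi)^\bullet$. $\to^\circ$: $\Lambda,\varphi^\bullet,\psi^\circ$ / $\Lambda,(\varphi\to\psi)^\circ$. $\Box^\bullet$: $\Gamma,\{\varphi^\bullet\}$ / $\Gamma,(\Box\varphi)^\bullet$. $\Box^\circ$ ($|\Delta|\leq 1$): $\Delta,\varphi^\circ$ / $\Lambda,\{\Delta\},(\Box\varphi)^\circ$. $\Diamond^\bullet$ ($|\Delta|\leq 1$): $\varphi^\bullet,\Delta$ / $\Gamma,(\Diamond\varphi)^\bullet,\{\Delta\}$. $\Diamond^\circ$: $\Lambda,\{\varphi^\circ\}$ / $\Lambda,(\Diamond\varphi)^\circ$. $\mathcal{C}_{\mathsf{IM}\oplus\mathrm{Ax}}$ extends $\mathcal{C}_{\mathsf{IM}}$ with the rules corresponding to the axioms in $\mathrm{Ax}$ ($\mathsf{n}$ for $\mathsf{N}$, $\mathsf{p}$ for $\mathsf{P}$, $\mathsf{d}$ for $\mathsf{D}$, $\mathsf{t}$ for $\mathsf{T}$),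 and additionally with $\mathsf{p}$ if $\mathsf{D}\in\mathrm{Ax}$; here $\Delta,\Sigma$ consist of marked formulas with $|\Delta|=|\Sigma|=1$: $\mathsf{n}$: $\Gamma,\{\ \}$ / $\Gamma$. $\mathsf{p}$: $\Delta$ / $\Gamma,\{\Delta\}$. $\mathsf{d}$: $\Delta,\Sigma$ / $\Gamma,\{\Delta\},\{\Sigma\}$. $\mathsf{t}$: $\Gamma,\{\Delta\}^\downarrow,\Delta$ / $\Gamma,\{\Delta\}$. -}

module Defs where

open import Data.List.Base using (List; []; _∷_; [_]; map; fromMaybe)
open import Data.List.Relation.Binary.Permutation.Propositional using (_↭_)
open import Data.Maybe.Base using (Maybe; just; nothing)
open import Data.Sum.Base using (_⊎_)
open import Level using (0ℓ)
open import Relation.Unary using (Pred; _∈_)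

infix  30 □_ ◇_ ¬_
infixr 27 _∧_
infixr 26 _∨_
infixr 25 _⇒_

-- Formulas over an arbitrary set A of proposition letters.
data Fm (A : Set) : Set where
  var         : A → Fm A
  ⊥           : Fm A
  _∧_ _∨_ _⇒_ : Fm A → Fm A → Fm A
  □_ ◇_       : Fm A → Fm A

variable
  A     : Set
  φ ψ χ : Fm A

¬_ : Fm A → Fm A
¬ φ = φ ⇒ ⊥

⊤ : Fm A
⊤ = ¬ ⊥

subst : (A → Fm A) → Fm A → Fm A
subst σ (var p) = σ p
subst σ ⊥       = ⊥
subst σ (φ ∧ ψ) = subst σ φ ∧ subst σ ψ
subst σ (φ ∨ ψ) = subst σ φ ∨ subst σ ψ
subst σ (φ ⇒ ψ) = subst σ φ ⇒ subst σ ψ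
subst σ (□ φ)   = □ subst σ φ
subst σ (◇ φ)   = ◇ subst σ φ

data AxName : Set where
  N P D T : AxName

-- N and P have a single instance, so they ignore the formula argument.
scheme : AxName → Fm A → Fm A
scheme N φ = □ ⊤
scheme P φ = ◇ ⊤
scheme D φ = □ φ ⇒ ◇ φ
scheme T φ = (□ φ ⇒ φ) ∧ (φ ⇒ ◇ φ)

infix 10 IM⊕_⊢_

-- Axioms are given as schemes; closure under uniform substitution is
-- nevertheless kept as a rule.
data IM⊕_⊢_ (Ax : Pred AxName 0ℓ) {A : Set} : Fm A → Set where
  ⇒-K   : IM⊕ Ax ⊢ φ ⇒ ψ ⇒ φ
  ⇒-S   : IM⊕ Ax ⊢ (φ ⇒ ψ ⇒ χ) ⇒ (φ ⇒ ψ) ⇒ φ ⇒ χ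
  ∧-I   : IM⊕ Ax ⊢ φ ⇒ ψ ⇒ φ ∧ ψ
  ∧-E₁  : IM⊕ Ax ⊢ φ ∧ ψ ⇒ φ
  ∧-E₂  : IM⊕ Ax ⊢ φ ∧ ψ ⇒ ψ
  ∨-I₁  : IM⊕ Ax ⊢ φ ⇒ φ ∨ ψ
  ∨-I₂  : IM⊕ Ax ⊢ ψ ⇒ φ ∨ ψ
  ∨-E   : IM⊕ Ax ⊢ (φ ⇒ χ) ⇒ (ψ ⇒ χ) ⇒ φ ∨ ψ ⇒ χ
  ⊥-E   : IM⊕ Ax ⊢ ⊥ ⇒ φ
  □◇¬   : IM⊕ Ax ⊢ □ φ ∧ ◇ ¬ φ ⇒ ⊥
  □⊤◇   : IM⊕ Ax ⊢ (□ ⊤ ⇒ ◇ φ) ⇒ ◇ φ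
  ax    : ∀ {a} → a ∈ Ax → IM⊕ Ax ⊢ scheme a φ
  mp    : IM⊕ Ax ⊢ φ ⇒ ψ → IM⊕ Ax ⊢ φ → IM⊕ Ax ⊢ ψ
  □-mon : IM⊕ Ax ⊢ φ ⇒ ψ → IM⊕ Ax ⊢ □ φ ⇒ □ ψ
  ◇-mon : IM⊕ Ax ⊢ φ ⇒ ψ → IM⊕ Ax ⊢ ◇ φ ⇒ ◇ ψ
  sub   : ∀ σ → IM⊕ Ax ⊢ φ → IM⊕ Ax ⊢ subst σ φ

infix 20 _• _°

-- ⟨ Δ ⟩ is the block {Δ}; in an input block every formula is an input formula,
-- so its mark is left implicit.
data Input (A : Set) : Set where
  _•  : Fm A → Input A
  ⟨_⟩ : Maybe (Fm A) → Input A

pattern ⟨⟩     = ⟨ nothing ⟩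
pattern ⟨_•⟩ φ = ⟨ just φ ⟩

data Output (A : Set) : Set where
  ∅    : Output A
  _°   : Fm A → Output A
  ⟨_°⟩ : Fm A → Output A

infix 3 _▷_

-- Λ ▷ Π is the sequent Λ,Π.  The list Λ stands for a multiset: derivability
-- is closed under permuting it (rule exch below).
record Sequent (A : Set) : Set where
  constructor _▷_
  field
    inputs : List (Input A)
    output : Output A

variable
  Λ Λ′ : List (Input A)
  Π    : Output A

infix 21 _↓

-- A pruned sequent has input components only, so it is given by their list.
_↓ : Sequent A → List (Input A)
(Λ ▷ ∅) ↓        = Λ
(Λ ▷ φ °) ↓      = Λ
(Λ ▷ ⟨ φ °⟩) ↓   = ⟨⟩ ∷ Λ

ι• : Input A → Fm A
ι• (φ •)   = φ
ι• ⟨⟩      = □ ⊤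
ι• ⟨ φ •⟩  = □ φ

ι° : Output A → Fm A
ι° ∅        = ⊥
ι° (φ °)    = φ
ι° ⟨ φ °⟩   = ◇ φ

⋀ : List (Fm A) → Fm A
⋀ []           = ⊤
⋀ (φ ∷ [])     = φ
⋀ (φ ∷ ψ ∷ φs) = φ ∧ ⋀ (ψ ∷ φs)

i : Sequent A → Fm A
i (Λ ▷ Π) = ⋀ (map ι• Λ) ⇒ ι° Π

infix 2 C⊕_⊢_

-- A context Γ is written Λ ▷ Π.  A rule with a block {Δ} whose formula may be
-- input or output becomes two constructors, the primed one for an output
-- formula; as the conclusion must be a sequent, an output block excludes any
-- other output.  For the same reason Δ in □° is always input, and in d at most
-- one of Δ, Σ is output (which one is immaterial, the rule being symmetric).
data C⊕_⊢_ (Ax : Pred AxName 0ℓ) {A : Set} : Sequent A → Set where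
  exch : Λ ↭ Λ′ → C⊕ Ax ⊢ Λ ▷ Π → C⊕ Ax ⊢ Λ′ ▷ Π

  ⊥•  : C⊕ Ax ⊢ ⊥ • ∷ Λ ▷ Π
  id  : ∀ {p} → C⊕ Ax ⊢ var p • ∷ Λ ▷ var p °
  ∧•  : C⊕ Ax ⊢ φ • ∷ ψ • ∷ Λ ▷ Π →
        C⊕ Ax ⊢ (φ ∧ ψ) • ∷ Λ ▷ Π
  ∧°  : C⊕ Ax ⊢ Λ ▷ φ ° →
        C⊕ Ax ⊢ Λ ▷ ψ ° →
        C⊕ Ax ⊢ Λ ▷ (φ ∧ ψ) °
  ∨•  : C⊕ Ax ⊢ φ • ∷ Λ ▷ Π →
        C⊕ Ax ⊢ ψ • ∷ Λ ▷ Π →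
        C⊕ Ax ⊢ (φ ∨ ψ) • ∷ Λ ▷ Π
  ∨°₁ : C⊕ Ax ⊢ Λ ▷ φ ° →
        C⊕ Ax ⊢ Λ ▷ (φ ∨ ψ) °
  ∨°₂ : C⊕ Ax ⊢ Λ ▷ ψ ° →
        C⊕ Ax ⊢ Λ ▷ (φ ∨ ψ) °
  ⇒•  : C⊕ Ax ⊢ (φ ⇒ ψ) • ∷ (Λ ▷ Π) ↓ ▷ φ ° →
        C⊕ Ax ⊢ ψ • ∷ Λ ▷ Π →
        C⊕ Ax ⊢ (φ ⇒ ψ) • ∷ Λ ▷ Π
  ⇒°  : C⊕ Ax ⊢ φ • ∷ Λ ▷ ψ ° →
        C⊕ Ax ⊢ Λ ▷ (φ ⇒ ψ) °
  □•  : C⊕ Ax ⊢ ⟨ φ •⟩ ∷ Λ ▷ Π →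
        C⊕ Ax ⊢ (□ φ) • ∷ Λ ▷ Π
  □°  : ∀ {Δ} →
        C⊕ Ax ⊢ map _• (fromMaybe Δ) ▷ φ ° →
        C⊕ Ax ⊢ ⟨ Δ ⟩ ∷ Λ ▷ (□ φ) °
  ◇•  : ∀ {Δ} →
        C⊕ Ax ⊢ φ • ∷ map _• (fromMaybe Δ) ▷ ∅ →
        C⊕ Ax ⊢ (◇ φ) • ∷ ⟨ Δ ⟩ ∷ Λ ▷ Π
  ◇•′ : C⊕ Ax ⊢ [ φ • ] ▷ ψ ° →
        C⊕ Ax ⊢ (◇ φ) • ∷ Λ ▷ ⟨ ψ °⟩
  ◇°  : C⊕ Ax ⊢ Λ ▷ ⟨ φ °⟩ →
        C⊕ Ax ⊢ Λ ▷ (◇ φ) °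

  n   : N ∈ Ax →
        C⊕ Ax ⊢ ⟨⟩ ∷ Λ ▷ Π →
        C⊕ Ax ⊢ Λ ▷ Π
  p   : P ∈ Ax ⊎ D ∈ Ax →
        C⊕ Ax ⊢ [ φ • ] ▷ ∅ →
        C⊕ Ax ⊢ ⟨ φ •⟩ ∷ Λ ▷ Π
  p′  : P ∈ Ax ⊎ D ∈ Ax →
        C⊕ Ax ⊢ [] ▷ φ ° →
        C⊕ Ax ⊢ Λ ▷ ⟨ φ °⟩
  d   : D ∈ Ax →
        C⊕ Ax ⊢ φ • ∷ ψ • ∷ [] ▷ ∅ →
        C⊕ Ax ⊢ ⟨ φ •⟩ ∷ ⟨ ψ •⟩ ∷ Λ ▷ Π
  d′  : D ∈ Ax →
        C⊕ Ax ⊢ [ φ • ] ▷ ψ ° →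
        C⊕ Ax ⊢ ⟨ φ •⟩ ∷ Λ ▷ ⟨ ψ °⟩
  t   : T ∈ Ax →
        C⊕ Ax ⊢ φ • ∷ ⟨ φ •⟩ ∷ Λ ▷ Π →
        C⊕ Ax ⊢ ⟨ φ •⟩ ∷ Λ ▷ Π
  t′  : T ∈ Ax →
        C⊕ Ax ⊢ (Λ ▷ ⟨ φ °⟩) ↓ ▷ φ ° →
        C⊕ Ax ⊢ Λ ▷ ⟨ φ °⟩

{-# OPTIONS --safe #-}
module Submission where

-- Induction on the derivation.  The rules that prune an output block add a
-- hypothesis □ ⊤ to their premiss; it is discharged by the axiom
-- (□ ⊤ ⇒ ◇ φ) ⇒ ◇ φ, the pruned formula being interpreted as some ◇ φ.

open import Data.List.Base using (List; []; _∷_; map)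
open import Data.List.Relation.Binary.Permutation.Propositional using (_↭_; ↭-sym)
open import Data.List.Relation.Binary.Permutation.Propositional.Properties using (All-resp-↭; map⁺)
open import Data.List.Relation.Unary.All using (All; []; _∷_)
open import Data.Maybe.Base using (just; nothing)
open import Data.Sum.Base using (_⊎_; inj₁; inj₂)
open import Level using (0ℓ)
open import Relation.Unary using (Pred; _∈_)
open import Defs

private variable
  Ax    : Pred AxName 0ℓ
  γ     : Fm A
  φs ψs : List (Fm A)

infixr 9 _∘_

K : IM⊕ Ax ⊢ φ → IM⊕ Ax ⊢ γ ⇒ φ
K = mp ⇒-K

app : IM⊕ Ax ⊢ γ ⇒ φ ⇒ ψ → IM⊕ Ax ⊢ γ ⇒ φ → IM⊕ Ax ⊢ γ ⇒ ψ
app f x = mp (mp ⇒-S f) x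

_∘_ : IM⊕ Ax ⊢ ψ ⇒ χ → IM⊕ Ax ⊢ φ ⇒ ψ → IM⊕ Ax ⊢ φ ⇒ χ
g ∘ f = app (K g) f

⇒-refl : IM⊕ Ax ⊢ φ ⇒ φ
⇒-refl {φ = φ} = app ⇒-K (⇒-K {ψ = φ})

⊤-I : IM⊕ Ax ⊢ γ ⇒ ⊤
⊤-I = K ⊥-E

pair : IM⊕ Ax ⊢ γ ⇒ φ → IM⊕ Ax ⊢ γ ⇒ ψ → IM⊕ Ax ⊢ γ ⇒ φ ∧ ψ
pair f g = app (∧-I ∘ f) g

curry : IM⊕ Ax ⊢ γ ∧ φ ⇒ ψ → IM⊕ Ax ⊢ γ ⇒ φ ⇒ ψ
curry f = mp ⇒-S (K f) ∘ ∧-I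

cases : IM⊕ Ax ⊢ γ ⇒ φ ∨ ψ → IM⊕ Ax ⊢ γ ⇒ φ ⇒ χ → IM⊕ Ax ⊢ γ ⇒ ψ ⇒ χ → IM⊕ Ax ⊢ γ ⇒ χ
cases x f g = app (app (∨-E ∘ f) g) x

-- `⋀` of a singleton carries no trailing `⊤`, hence the split on the remaining list here and below.
⋀-head : ∀ φs → IM⊕ Ax ⊢ ⋀ (φ ∷ φs) ⇒ φ
⋀-head []      = ⇒-refl
⋀-head (_ ∷ _) = ∧-E₁

⋀-tail : ∀ φs → IM⊕ Ax ⊢ ⋀ (φ ∷ φs) ⇒ ⋀ φs
⋀-tail []      = ⊤-I
⋀-tail (_ ∷ _) = ∧-E₂

⋀-cons : ∀ φs → IM⊕ Ax ⊢ γ ⇒ φ → IM⊕ Ax ⊢ γ ⇒ ⋀ φs → IM⊕ Ax ⊢ γ ⇒ ⋀ (φ ∷ φs)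
⋀-cons []      f _ = f
⋀-cons (_ ∷ _) f g = pair f g

⋀-intro : All (λ φ → IM⊕ Ax ⊢ γ ⇒ φ) φs → IM⊕ Ax ⊢ γ ⇒ ⋀ φs
⋀-intro                []       = ⊤-I
⋀-intro {φs = _ ∷ φs} (f ∷ fs) = ⋀-cons φs f (⋀-intro fs)

⋀-elim : ∀ φs → IM⊕ Ax ⊢ γ ⇒ ⋀ φs → All (λ φ → IM⊕ Ax ⊢ γ ⇒ φ) φs
⋀-elim []       _ = []
⋀-elim (_ ∷ φs) f = ⋀-head φs ∘ f ∷ ⋀-elim φs (⋀-tail φs ∘ f)

-- With `γ` taken to be `⋀ φs`, the conjunction becomes an `All`, which can be permuted.
⋀-resp-↭ : φs ↭ ψs → IM⊕ Ax ⊢ ⋀ φs ⇒ ⋀ ψs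
⋀-resp-↭ {φs = φs} φs↭ψs = ⋀-intro (All-resp-↭ φs↭ψs (⋀-elim φs ⇒-refl))

-- The component `x` is explicit because `ι•` is not injective: `(□ φ) •` and `⟨ φ •⟩` are both read
-- as `□ φ`.
head : ∀ x (Λ : List (Input A)) → IM⊕ Ax ⊢ ⋀ (map ι• (x ∷ Λ)) ⇒ ι• x
head _ Λ = ⋀-head (map ι• Λ)

tail : ∀ x (Λ : List (Input A)) → IM⊕ Ax ⊢ ⋀ (map ι• (x ∷ Λ)) ⇒ ⋀ (map ι• Λ)
tail _ Λ = ⋀-tail (map ι• Λ)

cons : ∀ x (Λ : List (Input A)) → IM⊕ Ax ⊢ γ ⇒ ι• x → IM⊕ Ax ⊢ γ ⇒ ⋀ (map ι• Λ) →
       IM⊕ Ax ⊢ γ ⇒ ⋀ (map ι• (x ∷ Λ))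
cons _ Λ = ⋀-cons (map ι• Λ)

discharge : ∀ x (Λ : List (Input A)) → IM⊕ Ax ⊢ ⋀ (map ι• (x ∷ Λ)) ⇒ ψ →
            IM⊕ Ax ⊢ ⋀ (map ι• Λ) ⇒ ι• x ⇒ ψ
discharge x Λ f = curry (f ∘ cons x Λ ∧-E₂ ∧-E₁)

-- `γ` may be stronger than the conjunction of `Λ`: for `⇒•` it also holds the principal
-- implication.
prune : ∀ (Λ : List (Input A)) Π → IM⊕ Ax ⊢ γ ⇒ ⋀ (map ι• Λ) →
        IM⊕ Ax ⊢ γ ⇒ ⋀ (map ι• ((Λ ▷ Π) ↓)) ⇒ ι° Π → IM⊕ Ax ⊢ γ ⇒ ι° Π
prune Λ ∅      f g = app g f
prune Λ (_ °)  f g = app g f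
-- The outer `∧-E₂` projects the temporary assumption `□ ⊤`, which supplies the emptied block.
prune Λ ⟨ _ °⟩ f g = □⊤◇ ∘ curry (app (g ∘ ∧-E₁) (cons ⟨⟩ Λ ∧-E₂ (f ∘ ∧-E₁)))

-- Monotonicity turns `◇ φ` into `◇ ¬ ψ`, which clashes with `□ ψ`. This covers the rules whose
-- premiss has empty output.
□◇-absurd : IM⊕ Ax ⊢ φ ⇒ ¬ ψ → IM⊕ Ax ⊢ γ ⇒ □ ψ → IM⊕ Ax ⊢ γ ⇒ ◇ φ → IM⊕ Ax ⊢ γ ⇒ χ
□◇-absurd f x y = ⊥-E ∘ □◇¬ ∘ pair x (◇-mon f ∘ y)

◇⊤ : P ∈ Ax ⊎ D ∈ Ax → IM⊕ Ax ⊢ ◇ (⊤ {A})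
◇⊤ (inj₁ P∈Ax) = ax {φ = ⊤} P∈Ax
-- The instance `□ ⊤ ⇒ ◇ ⊤` of `D`, whose antecedent `□⊤◇` removes.
◇⊤ (inj₂ D∈Ax) = mp □⊤◇ (ax D∈Ax)

soundness : ∀ {Γ : Sequent A} → C⊕ Ax ⊢ Γ → IM⊕ Ax ⊢ i Γ
soundness (exch Λ↭Λ′ f) = soundness f ∘ ⋀-resp-↭ (map⁺ ι• (↭-sym Λ↭Λ′))
soundness (⊥• {Λ = Λ}) = ⊥-E ∘ head (⊥ •) Λ
soundness (id {Λ = Λ} {p = q}) = head (var q •) Λ
soundness (∧• {φ = φ} {ψ = ψ} {Λ = Λ} f) =
  soundness f ∘ cons (φ •) (ψ • ∷ Λ) (∧-E₁ ∘ head ((φ ∧ ψ) •) Λ)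
                  (cons (ψ •) Λ (∧-E₂ ∘ head ((φ ∧ ψ) •) Λ) (tail ((φ ∧ ψ) •) Λ))
soundness (∧° f g) = pair (soundness f) (soundness g)
soundness (∨• {φ = φ} {Λ = Λ} {ψ = ψ} f g) =
  cases (head ((φ ∨ ψ) •) Λ)
        (discharge (φ •) Λ (soundness f) ∘ tail ((φ ∨ ψ) •) Λ)
        (discharge (ψ •) Λ (soundness g) ∘ tail ((φ ∨ ψ) •) Λ)
soundness (∨°₁ f) = ∨-I₁ ∘ soundness f
soundness (∨°₂ f) = ∨-I₂ ∘ soundness f
soundness (⇒• {φ = φ} {ψ = ψ} {Λ = Λ} {Π = Π} f g) =
  -- Under the pruned context the first premiss yields `φ`, so the implication yields `ψ`; the
  -- second premiss then uses the unpruned `Λ`.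
  prune Λ Π rest (curry (app (discharge (ψ •) Λ (soundness g) ∘ rest ∘ ∧-E₁)
                             (app (imp ∘ ∧-E₁) (soundness f ∘ premiss))))
  where
  imp     = head ((φ ⇒ ψ) •) Λ
  rest    = tail ((φ ⇒ ψ) •) Λ
  premiss = cons ((φ ⇒ ψ) •) ((Λ ▷ Π) ↓) (imp ∘ ∧-E₁) ∧-E₂
soundness (⇒° {φ = φ} {Λ = Λ} f) = discharge (φ •) Λ (soundness f)
soundness (□• {φ = φ} {Λ = Λ} f) =
  soundness f ∘ cons ⟨ φ •⟩ Λ (head ((□ φ) •) Λ) (tail ((□ φ) •) Λ)
-- The premiss has no inputs and reads `⊤ ⇒ φ`, matching the reading `□ ⊤` of the empty block.
soundness (□° {Λ = Λ} {Δ = nothing} f) = □-mon (soundness f) ∘ head ⟨⟩ Λ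
soundness (□° {Λ = Λ} {Δ = just ψ}  f) = □-mon (soundness f) ∘ head ⟨ ψ •⟩ Λ
soundness (◇• {φ = φ} {Λ = Λ} {Δ = nothing} f) =
  -- The premiss `φ ⇒ ⊥` is weakened to `φ ⇒ ¬ ⊤`, to clash with `□ ⊤`.
  □◇-absurd (curry (soundness f ∘ ∧-E₁)) (head ⟨⟩ Λ ∘ tail ((◇ φ) •) (⟨⟩ ∷ Λ))
                                         (head ((◇ φ) •) (⟨⟩ ∷ Λ))
soundness (◇• {φ = φ} {Λ = Λ} {Δ = just ψ} f) =
  □◇-absurd (curry (soundness f)) (head ⟨ ψ •⟩ Λ ∘ tail ((◇ φ) •) (⟨ ψ •⟩ ∷ Λ))
                                  (head ((◇ φ) •) (⟨ ψ •⟩ ∷ Λ))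
soundness (◇•′ {φ = φ} {Λ = Λ} f) = ◇-mon (soundness f) ∘ head ((◇ φ) •) Λ
soundness (◇° f) = soundness f
soundness (n {Λ = Λ} N∈Ax f) = soundness f ∘ cons ⟨⟩ Λ (K (ax {φ = ⊤} N∈Ax)) ⇒-refl
soundness (p {φ = φ} {Λ = Λ} PD f) =
  -- The premiss is `¬ φ`, so `◇ ⊤` gives `◇ ¬ φ`.
  □◇-absurd (K (soundness f)) (head ⟨ φ •⟩ Λ) (K (◇⊤ PD))
soundness (p′ PD f) = K (mp (◇-mon (soundness f)) (◇⊤ PD))
soundness (d {φ = φ} {ψ = ψ} {Λ = Λ} D∈Ax f) =
  -- `D` turns the first block into `◇ φ`, while `φ` refutes the content `ψ` of the second.
  □◇-absurd (curry (soundness f)) (head ⟨ ψ •⟩ Λ ∘ tail ⟨ φ •⟩ (⟨ ψ •⟩ ∷ Λ))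
                                  (ax D∈Ax ∘ head ⟨ φ •⟩ (⟨ ψ •⟩ ∷ Λ))
soundness (d′ {φ = φ} {Λ = Λ} D∈Ax f) = ◇-mon (soundness f) ∘ ax D∈Ax ∘ head ⟨ φ •⟩ Λ
soundness (t {φ = φ} {Λ = Λ} T∈Ax f) =
  soundness f ∘ cons (φ •) (⟨ φ •⟩ ∷ Λ) (mp ∧-E₁ (ax T∈Ax) ∘ head ⟨ φ •⟩ Λ) ⇒-refl
soundness (t′ {Λ = Λ} {φ = φ} T∈Ax f) =
  -- The half `φ ⇒ ◇ φ` of `T` restores the `◇`-formula that `prune` needs.
  prune Λ ⟨ φ °⟩ ⇒-refl (K (mp ∧-E₂ (ax T∈Ax) ∘ soundness f))

theorem4p4 : (A : Set) (Ax : Pred AxName 0ℓ) (Γ : Sequent A) → C⊕ Ax ⊢ Γ → IM⊕ Ax ⊢ i Γ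
theorem4p4 A Ax Γ = soundness
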